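{- If $G$ is a connected graph of maximum degree at most $3$, then $\gamma_e(G)\leq \frac{1}{3}(n(G)+2)$, where $n(G)$ is the order of $G$.
   Context: All graphs are finite, simple and undirected. For a graph $G$ and $S\subseteq V(G)$, and vertices $u,v$ with $u\in S$ or $v\in S$, let $\mathrm{dist}_{(G,S)}(u,v)$ be the minimum number of edges of a path $P$ in $G$ between $u$ and $v$ such that $S$ contains exactly one endvertex of $P$ and no internal vertex of $P$ (and $\infty$ if no such path exists; in particular $\mathrm{dist}_{(G,S)}(u,u)=0$ for $u\in S$). For a vertex $u$, let $w_{(G,S)}(u)=\sum_{v\in S}\left(\frac{1}{2}\right)^{\mathrm{dist}_{(G,S)}(u,v)-1}$ with $(1/2)^\infty=0$. The set $S$ is an exponential dominating set of $G$ if $w_{(G,S)}(u)\geq 1$ for every vertex $u$ of $G$. The exponential domination number $\gamma_e(G)$ is the minimum cardinality of an exponential dominating set of $G$. -}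

module Defs where

open import Data.Nat using (ℕ; zero; suc; _≤_)
open import Data.Bool using (Bool; true; false; if_then_else_)
open import Data.Fin using (Fin)
open import Data.Fin.Subset using (Subset; _∈_; _∉_; inside; outside)
open import Data.List using (List; []; _∷_; _∷ʳ_; length; map; allFin; foldr)
open import Data.Nat.ListAction using (sum)
open import Data.List.Relation.Unary.All using (All)
open import Data.List.Relation.Unary.Linked using (Linked)
open import Data.List.Relation.Unary.Unique.Propositional using (Unique)
open import Data.Maybe using (Maybe; just; nothing)
open import Data.Product using (Σ; _×_; ∃)
open import Data.Sum using (_⊎_)
open import Data.Vec using (lookup)
open import Data.Rational using (ℚ; 0ℚ; 1ℚ; ½; _*_; _+_) renaming (_≤_ to _≤ℚ_)
open import Relation.Binary.PropositionalEquality using (_≡_; _≢_)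
open import Relation.Binary.Construct.Closure.ReflexiveTransitive using (Star)
open import Relation.Nullary using (¬_)

record Graph (n : ℕ) : Set where
  field
    adj   : Fin n → Fin n → Bool
    sym   : ∀ u v → adj u v ≡ adj v u
    irrefl : ∀ v → adj v v ≡ false

module _ {n : ℕ} (G : Graph n) where
  open Graph G

  Adj : Fin n → Fin n → Set
  Adj u v = adj u v ≡ true

  degree : Fin n → ℕ
  degree v = sum (map (λ w → if adj v w then 1 else 0) (allFin n))

  MaxDegreeAtMost : ℕ → Set
  MaxDegreeAtMost d = ∀ v → degree v ≤ d

  Connected : Set
  Connected = ∀ u v → Star Adj u v

  -- IsSPath S u v k : there is a path P in G between u and v with k edges,
  -- S contains exactly one endvertex of P and no internal vertex of P.
  -- The trivial path (u = v, k = 0) qualifies iff u ∈ S.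
  -- A nontrivial path has vertex list u ∷ mid ∷ʳ v (all distinct), internal vertices mid.
  IsSPath : Subset n → Fin n → Fin n → ℕ → Set
  IsSPath S u v k =
    (u ≡ v × u ∈ S × k ≡ 0)
    ⊎ Σ (List (Fin n)) λ mid →
        u ≢ v
      × Linked Adj (u ∷ mid ∷ʳ v)
      × Unique (u ∷ mid ∷ʳ v)
      × All (_∉ S) mid
      × ((u ∈ S × v ∉ S) ⊎ (u ∉ S × v ∈ S))
      × k ≡ suc (length mid)

  -- IsDist S u v d : dist_(G,S)(u,v) = d, where nothing encodes ∞.
  IsDist : Subset n → Fin n → Fin n → Maybe ℕ → Set
  IsDist S u v (just k) = IsSPath S u v k × (∀ k' → IsSPath S u v k' → k ≤ k')
  IsDist S u v nothing  = ∀ k → ¬ IsSPath S u v k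

half^ : ℕ → ℚ
half^ zero    = 1ℚ
half^ (suc m) = ½ * half^ m

-- (1/2)^(d-1) for d ∈ ℕ ∪ {∞}, with (1/2)^∞ = 0 and (1/2)^(-1) = 2
expTerm : Maybe ℕ → ℚ
expTerm nothing        = 0ℚ
expTerm (just zero)    = 1ℚ + 1ℚ
expTerm (just (suc d)) = half^ d

sumℚ : {n : ℕ} → (Fin n → ℚ) → ℚ
sumℚ {n} f = foldr (λ v acc → f v + acc) 0ℚ (allFin n)

module _ {n : ℕ} (G : Graph n) where

  weight : Subset n → (Fin n → Fin n → Maybe ℕ) → Fin n → ℚ
  weight S D u = sumℚ (λ v → if lookup S v then expTerm (D u v) else 0ℚ)

  IsExpDominating : Subset n → Set
  IsExpDominating S =
    Σ (Fin n → Fin n → Maybe ℕ) λ D →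
        (∀ u v → v ∈ S → IsDist G S u v (D u v))
      × (∀ u → 1ℚ ≤ℚ weight S D u)

{-# OPTIONS --safe #-}

-- Deleting edges only lengthens distances, so a spanning tree of G may replace G.
-- In a tree, contributions propagate along edges: a vertex of S contributes 1 to each
-- neighbour, and a vertex outside S contributes to a neighbour half of what it
-- receives from its other neighbours.  Call a marking S of a rooted subtree t
-- "giving" if the root contributes 1 to its parent, and "needy" if it dominates t
-- only once the root receives 1 from its parent; put c = 3|S| - |t|.  By induction
-- every t with at most two children per vertex has
--   (A) a marking that is not needy with c ≤ 0, or
--   (B) a needy marking with c ≤ -1 and a giving, not needy one with c ≤ 2, or
--   (C) a giving, not needy marking with c ≤ 1.
-- With the root unmarked, the kinds of the child subtrees combine as AA → B, AC → A,
-- BC → B (needy) and CC → C; with the root marked, as AA → B, AB → C, BB → A and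
-- BC → B (giving).  Finally, the two subtrees at the ends of an edge, of any kinds,
-- have markings that serve each other with total c at most 2.
module Submission where

open import Defs
open import Data.Nat using (ℕ; _≤_; _*_; _+_)
open import Data.Fin.Subset using (Subset; ∣_∣)
open import Data.Product using (Σ; _×_)

open import Data.Nat using (zero; suc; _<_; z≤n; s≤s)
open import Data.Nat.ListAction using (sum)
open import Data.Nat.ListAction.Properties using (sum-++; sum-↭)
open import Data.Nat.Solver using (module +-*-Solver)
import Data.Nat.Properties as ℕ
open import Data.Rational using (ℚ; 0ℚ; 1ℚ; ½) renaming (_≤_ to _≤ℚ_; _+_ to _+ℚ_)
import Data.Rational.Properties as ℚ
open import Data.Bool using (Bool; true; false; T; _∧_; _∨_; if_then_else_)
open import Data.Bool.Properties using (T-∧; T-∨) renaming (_≟_ to _≟ᵇ_)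
open import Data.Unit using (⊤; tt)
open import Data.Fin using (Fin; zero; suc)
import Data.Fin.Properties as Fin
open import Data.Fin.Subset using (_∪_; ⋃; ⁅_⁆; inside; outside; _∈_; _∉_)
open import Data.Fin.Subset.Properties using (_∈?_; p⊆p∪q; q⊆p∪q; x∈⁅x⁆; ∣⁅x⁆∣≡1; ∣⊥∣≡0)
open import Data.List using (List; []; _∷_; _++_; _∷ʳ_; length; map; allFin; foldr)
open import Data.List.Properties using (length-++; length-tabulate; map-++; ++-identityʳ)
open import Data.List.Membership.Propositional using () renaming (_∈_ to _∈ₗ_)
open import Data.List.Membership.Propositional.Properties using (∈-allFin; ∈-∃++; ∈-++⁺ˡ; ∈-++⁺ʳ; ∈-++⁻)
import Data.List.Membership.DecPropositional as DecMembership
open import Data.List.Relation.Unary.All as All using (All; []; _∷_)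
import Data.List.Relation.Unary.All.Properties as All
open import Data.List.Relation.Unary.AllPairs using ([]; _∷_)
open import Data.List.Relation.Unary.Any using (here; there)
open import Data.List.Relation.Unary.Linked using (Linked; [-]; _∷_)
open import Data.List.Relation.Unary.Unique.Propositional using (Unique)
open import Data.List.Relation.Binary.Permutation.Propositional using (_↭_; refl; prep; swap; trans; ↭-sym; ↭-trans; ↭-reflexive; ↭⇒↭ₛ)
open import Data.List.Relation.Binary.Permutation.Propositional.Properties using (shift; ∈-resp-↭; ↭-length; map⁺; ++⁺ˡ; ++⁺ʳ; ++-comm; ++-assoc)
open import Data.List.Relation.Binary.Sublist.Propositional using (_⊆_; []; _∷_; ⊆-refl) renaming (_∷ʳ_ to _skip_)
import Data.List.Relation.Binary.Sublist.Propositional.Properties as Sublist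
import Data.List.Relation.Binary.Permutation.Setoid.Properties as Permutationₛ
open import Data.Maybe using (Maybe; just; nothing)
open import Data.Product using (∃; ∃₂; _,_; proj₁; proj₂)
open import Data.Sum using (_⊎_; inj₁; inj₂; [_,_]′)
open import Data.Vec using ([]; _∷_; lookup)
open import Data.Vec.Properties using ([]=⇒lookup)
open import Function using (_∘_; id)
open import Function.Bundles using (Equivalence)
open import Relation.Binary.Construct.Closure.ReflexiveTransitive using (Star; ε; _◅_)
open import Relation.Binary.PropositionalEquality as ≡ using (_≡_; _≢_; refl; cong; cong₂; subst)
open import Relation.Nullary using (¬_; Dec; yes; no; _×-dec_; ¬?; contradiction)

private
  variable
    A : Set
    n : ℕ

-- Lists without repetition

Unique-resp-↭ : {xs ys : List A} → xs ↭ ys → Unique xs → Unique ys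
Unique-resp-↭ {A} xs↭ys = Permutationₛ.Unique-resp-↭ (≡.setoid A) (↭⇒↭ₛ xs↭ys)

Unique-resp-⊆ : {xs ys : List A} → xs ⊆ ys → Unique ys → Unique xs
Unique-resp-⊆ [] [] = []
Unique-resp-⊆ (_ skip s) (_ ∷ uniq) = Unique-resp-⊆ s uniq
Unique-resp-⊆ (refl ∷ s) (fresh ∷ uniq) = Sublist.All-resp-⊆ s fresh ∷ Unique-resp-⊆ s uniq

-- Each `x` in turn is cut out of `ys`, and distinctness keeps the rest of `xs` within what remains.
-- With `allFin n` for `ys` this compares a sum over distinct vertices with the sum over all
-- vertices.
Unique-⊆⇒↭-++ : {xs ys : List A} → Unique xs → (∀ {v} → v ∈ₗ xs → v ∈ₗ ys) →
                ∃ λ zs → ys ↭ xs ++ zs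
Unique-⊆⇒↭-++ {ys = ys} [] sub = ys , refl
Unique-⊆⇒↭-++ {xs = x ∷ xs} (x∉xs ∷ uniq) sub with ∈-∃++ (sub (here refl))
... | ps , qs , refl =
  let zs , rest↭ = Unique-⊆⇒↭-++ uniq sub′ in zs , ↭-trans (shift x ps qs) (prep x rest↭)
  where
  sub′ : ∀ {v} → v ∈ₗ xs → v ∈ₗ ps ++ qs
  sub′ v∈xs with ∈-resp-↭ (shift x ps qs) (sub (there v∈xs))
  ... | here refl = contradiction refl (All.lookup x∉xs v∈xs)
  ... | there v∈  = v∈

first-child-↭ : (x : A) (l₁ l₂ O : List A) → l₁ ++ x ∷ l₂ ++ O ↭ x ∷ (l₁ ++ l₂) ++ O
first-child-↭ x l₁ l₂ O = ↭-trans (shift x l₁ (l₂ ++ O)) (prep x (↭-sym (++-assoc l₁ l₂ O)))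

second-child-↭ : (x : A) (l₁ l₂ O : List A) → l₂ ++ x ∷ l₁ ++ O ↭ x ∷ (l₁ ++ l₂) ++ O
second-child-↭ x l₁ l₂ O = ↭-trans (first-child-↭ x l₂ l₁ O) (prep x (++⁺ʳ O (++-comm l₂ l₁)))

Unique⇒length≤n : {xs : List (Fin n)} → Unique xs → length xs ≤ n
Unique⇒length≤n {n} {xs} uniq =
  let zs , all↭ = Unique-⊆⇒↭-++ uniq (λ {v} _ → ∈-allFin v) in begin
    length xs              ≤⟨ ℕ.m≤m+n _ _ ⟩
    length xs + length zs  ≡⟨ length-++ xs ⟨
    length (xs ++ zs)      ≡⟨ ↭-length all↭ ⟨
    length (allFin n)      ≡⟨ length-tabulate id ⟩
    n                      ∎
  where open ℕ.≤-Reasoning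

-- Subsets from lists

∣p∪q∣≤∣p∣+∣q∣ : (p q : Subset n) → ∣ p ∪ q ∣ ≤ ∣ p ∣ + ∣ q ∣
∣p∪q∣≤∣p∣+∣q∣ [] [] = z≤n
∣p∪q∣≤∣p∣+∣q∣ (outside ∷ p) (outside ∷ q) = ∣p∪q∣≤∣p∣+∣q∣ p q
∣p∪q∣≤∣p∣+∣q∣ (inside ∷ p) (outside ∷ q) = s≤s (∣p∪q∣≤∣p∣+∣q∣ p q)
∣p∪q∣≤∣p∣+∣q∣ (outside ∷ p) (inside ∷ q) =
  ℕ.≤-trans (s≤s (∣p∪q∣≤∣p∣+∣q∣ p q)) (ℕ.≤-reflexive (≡.sym (ℕ.+-suc _ _)))
∣p∪q∣≤∣p∣+∣q∣ (inside ∷ p) (inside ∷ q) =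
  s≤s (ℕ.≤-trans (∣p∪q∣≤∣p∣+∣q∣ p q) (ℕ.+-monoʳ-≤ ∣ p ∣ (ℕ.n≤1+n _)))

fromList : List (Fin n) → Subset n
fromList xs = ⋃ (map ⁅_⁆ xs)

∈-fromList : {xs : List (Fin n)} {v : Fin n} → v ∈ₗ xs → v ∈ fromList xs
∈-fromList {xs = x ∷ xs} (here refl) = p⊆p∪q (fromList xs) (x∈⁅x⁆ x)
∈-fromList {xs = x ∷ xs} (there v∈)  = q⊆p∪q ⁅ x ⁆ (fromList xs) (∈-fromList v∈)

∣fromList∣≤length : (xs : List (Fin n)) → ∣ fromList xs ∣ ≤ length xs
∣fromList∣≤length {n} [] = ℕ.≤-reflexive (∣⊥∣≡0 n)
∣fromList∣≤length (x ∷ xs) = begin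
  ∣ ⁅ x ⁆ ∪ fromList xs ∣      ≤⟨ ∣p∪q∣≤∣p∣+∣q∣ ⁅ x ⁆ (fromList xs) ⟩
  ∣ ⁅ x ⁆ ∣ + ∣ fromList xs ∣  ≡⟨ cong (_+ ∣ fromList xs ∣) (∣⁅x⁆∣≡1 x) ⟩
  suc ∣ fromList xs ∣          ≤⟨ s≤s (∣fromList∣≤length xs) ⟩
  suc (length xs)              ∎
  where open ℕ.≤-Reasoning

-- Rational sums

p≤p+q : ∀ {p q} → 0ℚ ≤ℚ q → p ≤ℚ p +ℚ q
p≤p+q {p} {q} 0≤q = ℚ.≤-trans (ℚ.≤-reflexive (≡.sym (ℚ.+-identityʳ p))) (ℚ.+-monoʳ-≤ p 0≤q)

p≤q+p : ∀ {p q} → 0ℚ ≤ℚ q → p ≤ℚ q +ℚ p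
p≤q+p {p} {q} 0≤q = ℚ.≤-trans (p≤p+q 0≤q) (ℚ.≤-reflexive (ℚ.+-comm p q))

half^-double : ∀ k → half^ (suc k) +ℚ half^ (suc k) ≡ half^ k
half^-double k = ≡.trans (≡.sym (ℚ.*-distribʳ-+ (half^ k) ½ ½)) (ℚ.*-identityˡ (half^ k))

half^-nonneg : ∀ k → 0ℚ ≤ℚ half^ k
half^-nonneg zero    = ℚ.nonNegative⁻¹ 1ℚ
half^-nonneg (suc k) = ℚ.≤-trans (ℚ.≤-reflexive (≡.sym (ℚ.*-zeroʳ ½))) (ℚ.*-monoˡ-≤-nonNeg ½ (half^-nonneg k))

half^-anti : ∀ {j k} → j ≤ k → half^ k ≤ℚ half^ j
half^-anti {k = zero} z≤n = ℚ.≤-refl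
half^-anti {k = suc k} z≤n = ℚ.≤-trans
  (ℚ.≤-trans (p≤p+q (half^-nonneg (suc k))) (ℚ.≤-reflexive (half^-double k)))
  (half^-anti {zero} {k} z≤n)
half^-anti (s≤s j≤k) = ℚ.*-monoˡ-≤-nonNeg ½ (half^-anti j≤k)

expTerm-nonneg : ∀ d → 0ℚ ≤ℚ expTerm d
expTerm-nonneg nothing        = ℚ.≤-refl
expTerm-nonneg (just zero)    = ℚ.nonNegative⁻¹ (1ℚ +ℚ 1ℚ)
expTerm-nonneg (just (suc d)) = half^-nonneg d

sumOver : (A → ℚ) → List A → ℚ
sumOver f = foldr (λ v acc → f v +ℚ acc) 0ℚ

module _ (f : A → ℚ) where

  sumOver-++ : ∀ xs ys → sumOver f (xs ++ ys) ≡ sumOver f xs +ℚ sumOver f ys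
  sumOver-++ [] ys = ≡.sym (ℚ.+-identityˡ _)
  sumOver-++ (x ∷ xs) ys = ≡.trans (cong (f x +ℚ_) (sumOver-++ xs ys)) (≡.sym (ℚ.+-assoc (f x) _ _))

  sumOver-↭ : ∀ {xs ys} → xs ↭ ys → sumOver f xs ≡ sumOver f ys
  sumOver-↭ refl = refl
  sumOver-↭ (prep x p) = cong (f x +ℚ_) (sumOver-↭ p)
  sumOver-↭ (swap {xs} {ys} x y p) = begin
    f x +ℚ (f y +ℚ sumOver f xs)    ≡⟨ ℚ.+-assoc (f x) (f y) _ ⟨
    (f x +ℚ f y) +ℚ sumOver f xs    ≡⟨ cong₂ _+ℚ_ (ℚ.+-comm (f x) (f y)) (sumOver-↭ p) ⟩
    (f y +ℚ f x) +ℚ sumOver f ys    ≡⟨ ℚ.+-assoc (f y) (f x) _ ⟩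
    f y +ℚ (f x +ℚ sumOver f ys)    ∎
    where open ≡.≡-Reasoning
  sumOver-↭ (trans p q) = ≡.trans (sumOver-↭ p) (sumOver-↭ q)

  module _ (f-nonneg : ∀ v → 0ℚ ≤ℚ f v) where

    sumOver-nonneg : ∀ xs → 0ℚ ≤ℚ sumOver f xs
    sumOver-nonneg [] = ℚ.≤-refl
    sumOver-nonneg (x ∷ xs) = ℚ.≤-trans (f-nonneg x) (p≤p+q (sumOver-nonneg xs))

    sumOver-++ˡ-≤ : ∀ xs ys → sumOver f xs ≤ℚ sumOver f (xs ++ ys)
    sumOver-++ˡ-≤ xs ys = ℚ.≤-trans (p≤p+q (sumOver-nonneg ys)) (ℚ.≤-reflexive (≡.sym (sumOver-++ xs ys)))

    sumOver-++ʳ-≤ : ∀ xs ys → sumOver f ys ≤ℚ sumOver f (xs ++ ys)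
    sumOver-++ʳ-≤ xs ys = ℚ.≤-trans (p≤q+p (sumOver-nonneg xs)) (ℚ.≤-reflexive (≡.sym (sumOver-++ xs ys)))

    ∈⇒≤sumOver : ∀ {v xs} → v ∈ₗ xs → f v ≤ℚ sumOver f xs
    ∈⇒≤sumOver {xs = x ∷ xs} (here refl) = p≤p+q (sumOver-nonneg xs)
    ∈⇒≤sumOver {xs = x ∷ xs} (there v∈) = ℚ.≤-trans (∈⇒≤sumOver v∈) (p≤q+p (f-nonneg x))

sumOver≤sumℚ : (f : Fin n → ℚ) → (∀ v → 0ℚ ≤ℚ f v) → ∀ {xs} → Unique xs → sumOver f xs ≤ℚ sumℚ f
sumOver≤sumℚ f f-nonneg {xs} uniq =
  let zs , all↭ = Unique-⊆⇒↭-++ uniq (λ {v} _ → ∈-allFin v) in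
  ℚ.≤-trans (sumOver-++ˡ-≤ f f-nonneg xs zs) (ℚ.≤-reflexive (≡.sym (sumOver-↭ f all↭)))

-- Bounded search for a least natural number

least? : {P : ℕ → Set} → (∀ k → Dec (P k)) → ∀ m →
         (∃ λ k → P k × (∀ j → P j → k ≤ j)) ⊎ (∀ k → k < m → ¬ P k)
least? P? zero = inj₂ λ _ ()
least? {P} P? (suc m) with least? P? m
... | inj₁ found = inj₁ found
... | inj₂ none with P? m
...   | yes Pm = inj₁ (m , Pm , λ j Pj → ℕ.≮⇒≥ (λ j<m → none j j<m Pj))
...   | no ¬Pm = inj₂ λ k k<1+m Pk →
  [ (λ k<m → none k k<m Pk) , (λ { refl → ¬Pm Pk }) ]′ (ℕ.m≤n⇒m<n∨m≡n (ℕ.≤-pred k<1+m))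

module _ (G : Graph n) where

  open DecMembership (Fin._≟_ {n}) using () renaming (_∈?_ to _∈ₗ?_)

  Adj-sym : ∀ {u v} → Adj G u v → Adj G v u
  Adj-sym {u} {v} e = ≡.trans (Graph.sym G v u) e

  neighbours≤degree : ∀ {x xs} → Unique xs → All (Adj G x) xs → length xs ≤ degree G x
  neighbours≤degree {x} {xs} uniq adj =
    let zs , all↭ = Unique-⊆⇒↭-++ uniq (λ {v} _ → ∈-allFin v) in begin
      length xs                            ≡⟨ count adj ⟨
      sum (map ind xs)                     ≤⟨ ℕ.m≤m+n _ _ ⟩
      sum (map ind xs) + sum (map ind zs)  ≡⟨ sum-++ (map ind xs) (map ind zs) ⟨
      sum (map ind xs ++ map ind zs)       ≡⟨ cong sum (map-++ ind xs zs) ⟨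
      sum (map ind (xs ++ zs))             ≡⟨ sum-↭ (map⁺ ind all↭) ⟨
      degree G x                           ∎
    where
    open ℕ.≤-Reasoning
    ind : Fin n → ℕ
    ind w = if Graph.adj G x w then 1 else 0
    count : ∀ {ys} → All (Adj G x) ys → sum (map ind ys) ≡ length ys
    count [] = refl
    count (e ∷ es) rewrite e = cong suc (count es)

  -- Walks avoiding S, and the distance

  -- Vertices may repeat: unlike paths, walks are decided by plain recursion on the length and can
  -- be freely prolonged by an edge. Both ends lie outside `S` as well.
  data Walk (S : Subset n) : ℕ → Fin n → Fin n → Set where
    stay : ∀ {u} → u ∉ S → Walk S 0 u u
    step : ∀ {k u w x} → u ∉ S → Adj G u w → Walk S k w x → Walk S (suc k) u x

  module _ {S : Subset n} where

    walk-start : ∀ {k u x} → Walk S k u x → u ∉ S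
    walk-start (stay u∉S)     = u∉S
    walk-start (step u∉S _ _) = u∉S

    walk-end : ∀ {k u x} → Walk S k u x → x ∉ S
    walk-end (stay u∉S)   = u∉S
    walk-end (step _ _ w) = walk-end w

    walk-snoc : ∀ {k u x y} → Walk S k u x → Adj G x y → y ∉ S → Walk S (suc k) u y
    walk-snoc (stay u∉S) e y∉S     = step u∉S e (stay y∉S)
    walk-snoc (step u∉S e′ w) e y∉S = step u∉S e′ (walk-snoc w e y∉S)

    walk? : ∀ k u x → Dec (Walk S k u x)
    walk? zero u x with u Fin.≟ x | u ∈? S
    ... | no u≢x | _       = no λ { (stay _) → u≢x refl }
    ... | yes _  | yes u∈S = no λ { (stay u∉S) → u∉S u∈S }
    ... | yes refl | no u∉S = yes (stay u∉S)
    walk? (suc k) u x with ¬? (u ∈? S) ×-dec Fin.any? (λ w → (Graph.adj G u w ≟ᵇ true) ×-dec walk? k w x)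
    ... | yes (u∉S , w , e , walk) = yes (step u∉S e walk)
    ... | no none = no λ { (step u∉S e walk) → none (u∉S , _ , e , walk) }

  -- The walk and the last edge have `k + 1` edges together, so the matching term of the weight is
  -- `half^ k`.
  Reach : Subset n → ℕ → Fin n → Fin n → Set
  Reach S k u v = ∃ λ x → Walk S k u x × Adj G x v

  reach? : ∀ S k u v → Dec (Reach S k u v)
  reach? S k u v = Fin.any? (λ x → walk? k u x ×-dec (Graph.adj G x v ≟ᵇ true))

  Route : Subset n → Fin n → List (Fin n) → Fin n → Set
  Route S u mid v = Linked (Adj G) (u ∷ mid ∷ʳ v) × Unique (u ∷ mid ∷ʳ v) × All (_∉ S) (u ∷ mid)

  route-suffix : ∀ {S u w mid v} → u ∈ₗ w ∷ mid → Route S w mid v →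
                 ∃ λ mid′ → Route S u mid′ v × length mid′ ≤ length mid
  route-suffix (here refl) r = _ , r , ℕ.≤-refl
  route-suffix {mid = _ ∷ _} (there u∈) (_ ∷ linked , _ ∷ uniq , _ ∷ avoid) =
    let mid′ , r , short = route-suffix u∈ (linked , uniq , avoid) in mid′ , r , ℕ.m≤n⇒m≤1+n short

  -- Loop erasure: if `u` already occurs on the route found from its successor, the part of that
  -- route starting at `u` replaces it.
  reach⇒route : ∀ {S k u x v} → v ∈ S → Walk S k u x → Adj G x v →
                ∃ λ mid → Route S u mid v × length mid ≤ k
  reach⇒route v∈S (stay u∉S) e =
    [] , (e ∷ [-] , ((λ { refl → u∉S v∈S }) ∷ []) ∷ [] ∷ [] , u∉S ∷ []) , z≤n
  reach⇒route {v = v} v∈S (step {u = u} {w = w} u∉S e walk) e′ with reach⇒route v∈S walk e′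
  ... | mid , r@(linked , uniq , avoid) , short with u ∈ₗ? w ∷ mid
  ...   | yes u∈ = let mid′ , r′ , short′ = route-suffix u∈ r in mid′ , r′ , ℕ.m≤n⇒m≤1+n (ℕ.≤-trans short′ short)
  ...   | no u∉  = w ∷ mid , (e ∷ linked , fresh ∷ uniq , u∉S ∷ avoid) , s≤s short
    where
    fresh : All (u ≢_) (w ∷ mid ∷ʳ v)
    fresh = All.++⁺ (All.¬Any⇒All¬ (w ∷ mid) u∉) ((λ { refl → u∉S v∈S }) ∷ [])

  route⇒reach : ∀ {S u v} mid → u ∉ S → Linked (Adj G) (u ∷ mid ∷ʳ v) → All (_∉ S) mid →
                Reach S (length mid) u v
  route⇒reach [] u∉S (e ∷ _) [] = _ , stay u∉S , e
  route⇒reach (w ∷ mid) u∉S (e ∷ linked) (w∉S ∷ avoid) =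
    let x , walk , e′ = route⇒reach mid w∉S linked avoid in x , step u∉S e walk , e′

  reach⇒SPath : ∀ {S k u v} → v ∈ S → Reach S k u v → ∃ λ j → IsSPath G S u v (suc j) × j ≤ k
  reach⇒SPath v∈S (x , walk , e) with reach⇒route v∈S walk e
  ... | mid , (linked , uniq , _ ∷ avoid) , short =
    length mid , inj₂ (mid , (λ { refl → u∉S v∈S }) , linked , uniq , avoid , inj₂ (u∉S , v∈S) , refl) , short
    where u∉S = walk-start walk

  distance : ∀ S u v → v ∈ S → ∃ (IsDist G S u v)
  distance S u v v∈S with u ∈? S
  distance S u v v∈S | yes u∈S with u Fin.≟ v
  ... | yes refl = just 0 , inj₁ (refl , u∈S , refl) , λ _ _ → z≤n
  -- Both ends lie in `S`, whereas a nontrivial path must have exactly one end there.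
  ... | no u≢v   = nothing , λ
    { _ (inj₁ (u≡v , _)) → u≢v u≡v
    ; _ (inj₂ (_ , _ , _ , _ , _ , inj₁ (_ , v∉S) , _)) → v∉S v∈S
    ; _ (inj₂ (_ , _ , _ , _ , _ , inj₂ (u∉S , _) , _)) → u∉S u∈S }
  -- A path has fewer than `n` internal vertices, so a search below `n` that finds nothing proves
  -- the distance infinite.
  distance S u v v∈S | no u∉S with least? (λ k → reach? S k u v) n
  ... | inj₁ (k , reach , least) = just (suc k) , path , minimal
    where
    minimal : ∀ k′ → IsSPath G S u v k′ → suc k ≤ k′
    minimal _ (inj₁ (_ , u∈S , _)) = contradiction u∈S u∉S
    minimal _ (inj₂ (mid , _ , linked , _ , avoid , _ , refl)) = s≤s (least _ (route⇒reach mid u∉S linked avoid))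
    -- Loop erasure might shorten the walk; leastness of `k` rules this out.
    path : IsSPath G S u v (suc k)
    path with reach⇒SPath v∈S reach
    ... | j , p , j≤k = subst (IsSPath G S u v) (ℕ.≤-antisym (s≤s j≤k) (minimal _ p)) p
  ... | inj₂ none = nothing , λ
    { _ (inj₁ (_ , u∈S , _)) → u∉S u∈S
    ; _ (inj₂ (mid , _ , linked , uniq , avoid , _ , _)) →
        none (length mid) (short mid uniq) (route⇒reach mid u∉S linked avoid) }
    where
    short : ∀ mid → Unique (u ∷ mid ∷ʳ v) → length mid < n
    short mid uniq = ℕ.≤-trans
      (s≤s (ℕ.≤-trans (ℕ.m≤m+n _ _) (ℕ.≤-reflexive (≡.sym (length-++ mid)))))
      (Unique⇒length≤n uniq)

  distOf : Subset n → Fin n → Fin n → Maybe ℕ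
  distOf S u v with v ∈? S
  ... | yes v∈S = proj₁ (distance S u v v∈S)
  -- A default value: `IsDist` is demanded only for `v ∈ S`, and `weight` counts only such `v`.
  ... | no _    = nothing

  distOf-correct : ∀ S u v → v ∈ S → IsDist G S u v (distOf S u v)
  distOf-correct S u v v∈S with v ∈? S
  ... | yes v∈S′ = proj₂ (distance S u v v∈S′)
  ... | no v∉S   = contradiction v∈S v∉S

  -- Contributions of single vertices to the weight

  share : Subset n → Fin n → Fin n → ℚ
  share S u v = if lookup S v then expTerm (distOf S u v) else 0ℚ

  share-nonneg : ∀ S u v → 0ℚ ≤ℚ share S u v
  share-nonneg S u v with lookup S v
  ... | true  = expTerm-nonneg (distOf S u v)
  ... | false = ℚ.≤-refl

  share-∈ : ∀ {S u v} → v ∈ S → share S u v ≡ expTerm (distOf S u v)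
  share-∈ {S} {u} {v} v∈S rewrite []=⇒lookup v∈S = refl

  -- The walk yields a path with at most `k + 1` edges, and `expTerm` decreases with the distance.
  share-reach : ∀ {S k u v} → v ∈ S → Reach S k u v → half^ k ≤ℚ share S u v
  share-reach {S} {k} {u} {v} v∈S reach = subst (half^ k ≤ℚ_) (≡.sym (share-∈ {S} {u} v∈S)) bound
    where
    bound : half^ k ≤ℚ expTerm (distOf S u v)
    bound with distOf S u v | distOf-correct S u v v∈S | reach⇒SPath v∈S reach
    ... | nothing      | unreachable | j , p , _    = contradiction p (unreachable _)
    -- The term is 2 here, above every `half^ k`, so the bound holds without refuting the case.
    ... | just zero    | _           | _            =
      ℚ.≤-trans (half^-anti {j = 0} {k} z≤n) (p≤p+q (ℚ.nonNegative⁻¹ 1ℚ))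
    ... | just (suc d) | _ , minimal | j , p , j≤k  = half^-anti (ℕ.≤-trans (ℕ.≤-pred (minimal _ p)) j≤k)

  share-self : ∀ {S v} → v ∈ S → 1ℚ ≤ℚ share S v v
  share-self {S} {v} v∈S = subst (1ℚ ≤ℚ_) (≡.sym (share-∈ {S} {v} v∈S)) bound
    where
    bound : 1ℚ ≤ℚ expTerm (distOf S v v)
    bound with distOf S v v | distOf-correct S v v v∈S
    ... | nothing      | unreachable = contradiction (inj₁ (refl , v∈S , refl)) (unreachable 0)
    ... | just zero    | _           = p≤p+q (ℚ.nonNegative⁻¹ 1ℚ)
    ... | just (suc d) | _ , minimal = contradiction (minimal 0 (inj₁ (refl , v∈S , refl))) λ ()

  -- Spanning trees

  -- The children of p together with all their descendants: first child x, the
  -- descendants of x, the remaining children of p.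
  data Forest (p : Fin n) : Set where
    nil  : Forest p
    cons : ∀ x → Adj G p x → Forest x → Forest p → Forest p

  vertices : ∀ {p} → Forest p → List (Fin n)
  vertices nil = []
  vertices (cons x _ F F′) = x ∷ vertices F ++ vertices F′

  graft : ∀ {p q y} (F : Forest p) → q ∈ₗ p ∷ vertices F → Adj G q y →
          ∃ λ (F′ : Forest p) → vertices F′ ↭ y ∷ vertices F
  graft {y = y} F (here refl) e = cons y e nil F , refl
  graft {y = y} (cons x e′ F₁ F₂) (there q∈) e with ∈-++⁻ (x ∷ vertices F₁) q∈
  ... | inj₁ q∈₁ = let F₁′ , F₁′↭ = graft F₁ q∈₁ e in
    cons x e′ F₁′ F₂ , ↭-trans (prep x (++⁺ʳ (vertices F₂) F₁′↭)) (swap x y refl)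
  ... | inj₂ q∈₂ = let F₂′ , F₂′↭ = graft F₂ (there q∈₂) e in
    cons x e′ F₁ F₂′ , ↭-trans (++⁺ˡ (x ∷ vertices F₁) F₂′↭) (shift y (x ∷ vertices F₁) (vertices F₂))

  module _ {r : Fin n} where

    SubTree : Set
    SubTree = ∃ λ (F : Forest r) → Unique (r ∷ vertices F)

    _∈ₜ_ : Fin n → SubTree → Set
    v ∈ₜ (F , _) = v ∈ₗ r ∷ vertices F

    _⊑_ : SubTree → SubTree → Set
    F ⊑ F′ = ∀ {v} → v ∈ₜ F → v ∈ₜ F′

    -- The path is followed with its current vertex always in the tree; a next vertex not yet
    -- present is grafted onto the current one as a leaf.
    grow : ∀ (F : SubTree) {u z} → u ∈ₜ F → Star (Adj G) u z → ∃ λ F′ → F ⊑ F′ × z ∈ₜ F′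
    grow F u∈ ε = F , id , u∈
    grow F@(F₀ , uniq) u∈ (_◅_ {j = w} e es) with w ∈ₗ? r ∷ vertices F₀
    ... | yes w∈ = grow F w∈ es
    ... | no w∉ =
      let F₁ , F₁↭ = graft F₀ u∈ e
          all↭ = ↭-trans (swap w r refl) (prep r (↭-sym F₁↭))
          uniq₁ = Unique-resp-↭ all↭ (All.¬Any⇒All¬ _ w∉ ∷ uniq)
          F′ , F₁⊑F′ , z∈ = grow (F₁ , uniq₁) (∈-resp-↭ all↭ (here refl)) es
      in F′ , F₁⊑F′ ∘ ∈-resp-↭ all↭ ∘ there , z∈

    growAll : Connected G → ∀ zs → ∃ λ (F : SubTree) → All (_∈ₜ F) zs
    growAll conn [] = (nil , [] ∷ []) , []
    growAll conn (z ∷ zs) =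
      let F , zs∈ = growAll conn zs
          F′ , F⊑F′ , z∈ = grow F (here refl) (conn r z)
      in F′ , z∈ ∷ All.map F⊑F′ zs∈

  -- The vertex `p` lies above the tree, not in it: a nonempty `Tree p` includes the edge from `p`
  -- to its root, along which contributions pass. Missing children are `empty`.
  data Tree (p : Fin n) : Set where
    empty : Tree p
    node  : ∀ x → Adj G p x → Tree x → Tree x → Tree p

  labels : ∀ {p} → Tree p → List (Fin n)
  labels empty = []
  labels (node x _ t₁ t₂) = x ∷ labels t₁ ++ labels t₂

  roots : ∀ {p} → Forest p → List (Fin n)
  roots nil = []
  roots (cons x _ _ F) = x ∷ roots F

  roots-adj : ∀ {p} (F : Forest p) → All (Adj G p) (roots F)
  roots-adj nil = []
  roots-adj (cons x e _ F) = e ∷ roots-adj F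

  roots-⊆ : ∀ {p} (F : Forest p) → roots F ⊆ vertices F
  roots-⊆ nil = []
  roots-⊆ (cons x _ F₁ F₂) = refl ∷ Sublist.++⁺ˡ (vertices F₁) (roots-⊆ F₂)

  binarize : MaxDegreeAtMost G 3 → ∀ {p x} → Adj G p x → (F : Forest x) → Unique (p ∷ x ∷ vertices F) →
             ∃₂ λ (t₁ t₂ : Tree x) → labels t₁ ++ labels t₂ ≡ vertices F
  binarize deg e nil uniq = empty , empty , refl
  binarize deg {p} {x} e (cons y e₁ F₁ nil) uniq =
    let s , s′ , eq = binarize deg e₁ F₁ (Unique-resp-⊆ (p skip (refl ∷ refl ∷ Sublist.++⁺ʳ [] ⊆-refl)) uniq)
    in node y e₁ s s′ , empty , cong (λ l → y ∷ l ++ []) eq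
  binarize deg {p} {x} e (cons y e₁ F₁ (cons z e₂ F₂ nil)) uniq =
    let s₁ , s₁′ , eq₁ = binarize deg e₁ F₁ (Unique-resp-⊆
          (p skip (refl ∷ refl ∷ Sublist.++⁺ʳ _ ⊆-refl)) uniq)
        s₂ , s₂′ , eq₂ = binarize deg e₂ F₂ (Unique-resp-⊆
          (p skip (refl ∷ (y skip Sublist.++⁺ˡ (vertices F₁) (refl ∷ Sublist.++⁺ʳ [] ⊆-refl)))) uniq)
    in node y e₁ s₁ s₁′ , node z e₂ s₂ s₂′ ,
       cong₂ (λ l₁ l₂ → y ∷ l₁ ++ z ∷ l₂) eq₁ (≡.trans eq₂ (≡.sym (++-identityʳ _)))
  -- The parent `p` and three children would be four distinct neighbours of `x`.
  binarize deg {p} {x} e F@(cons _ _ _ (cons _ _ _ (cons _ _ _ _))) uniq =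
    contradiction
      (ℕ.≤-trans
        (neighbours≤degree (Unique-resp-⊆ (refl ∷ (x skip roots-⊆ F)) uniq) (Adj-sym e ∷ roots-adj F))
        (deg x))
      λ { (s≤s (s≤s (s≤s ()))) }

  -- Plans for trees

  -- Plan t out need M : a choice M of marked vertices in t : Tree p, which promises
  -- a contribution 1 to p if out holds, and which dominates t provided that, if need
  -- holds, the root of t receives a contribution 1 from outside t.  An unmarked
  -- vertex hands on half of what it receives, so it contributes 1 to one
  -- neighbour when it receives 1 from each of the two others.
  data Plan {p : Fin n} : Tree p → Bool → Bool → List (Fin n) → Set where
    none     : Plan empty false false []
    marked   : ∀ {x e t₁ t₂ o₁ o₂ d₁ d₂ M₁ M₂ o} →
               Plan t₁ o₁ d₁ M₁ → Plan t₂ o₂ d₂ M₂ →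
               Plan (node x e t₁ t₂) o false (x ∷ M₁ ++ M₂)
    unmarked : ∀ {x e t₁ t₂ o₁ o₂ d₁ d₂ M₁ M₂ d} →
               Plan t₁ o₁ d₁ M₁ → Plan t₂ o₂ d₂ M₂ →
               T (d ∨ o₁ ∨ o₂) → (T d₁ → T (d ∧ o₂)) → (T d₂ → T (d ∧ o₁)) →
               Plan (node x e t₁ t₂) (o₁ ∧ o₂) d (M₁ ++ M₂)

  -- c bounds 3 |M| - |t|, shifted by 1 to stay in ℕ.
  record Priced {p} (t : Tree p) (out need : Bool) (c : ℕ) : Set where
    constructor priced
    field
      {marks} : List (Fin n)
      plan    : Plan t out need marks
      price   : 1 + 3 * length marks ≤ length (labels t) + c

  private
    add-prices : ∀ {m₁ m₂ s₁ s₂ c₁ c₂} → 1 + 3 * m₁ ≤ s₁ + c₁ → 1 + 3 * m₂ ≤ s₂ + c₂ →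
                 2 + 3 * (m₁ + m₂) ≤ (s₁ + s₂) + (c₁ + c₂)
    add-prices {m₁} {m₂} {s₁} {s₂} {c₁} {c₂} h₁ h₂ = begin
      2 + 3 * (m₁ + m₂)           ≡⟨ solve 2 (λ a b → con 2 :+ con 3 :* (a :+ b) := (con 1 :+ con 3 :* a) :+ (con 1 :+ con 3 :* b)) refl m₁ m₂ ⟩
      (1 + 3 * m₁) + (1 + 3 * m₂) ≤⟨ ℕ.+-mono-≤ h₁ h₂ ⟩
      (s₁ + c₁) + (s₂ + c₂)       ≡⟨ solve 4 (λ a b c d → (a :+ b) :+ (c :+ d) := (a :+ c) :+ (b :+ d)) refl s₁ c₁ s₂ c₂ ⟩
      (s₁ + s₂) + (c₁ + c₂)       ∎
      where
      open ℕ.≤-Reasoning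
      open +-*-Solver

    add-marks : ∀ {A : Set} (M₁ M₂ l₁ l₂ : List A) {c₁ c₂} →
                1 + 3 * length M₁ ≤ length l₁ + c₁ → 1 + 3 * length M₂ ≤ length l₂ + c₂ →
                2 + 3 * length (M₁ ++ M₂) ≤ length (l₁ ++ l₂) + (c₁ + c₂)
    add-marks M₁ M₂ l₁ l₂ h₁ h₂ rewrite length-++ M₁ {M₂} | length-++ l₁ {l₂} =
      add-prices {length M₁} {length M₂} {length l₁} {length l₂} h₁ h₂

  module _ {p x : Fin n} {e : Adj G p x} {t₁ t₂ : Tree x} {o₁ o₂ d₁ d₂ : Bool} {c₁ c₂ : ℕ} where

    -- A marked root adds 3 - 1 = 2 to the difference; one unit is offset because the two shifts of
    -- the children become a single one.
    mark : ∀ {o} → Priced t₁ o₁ d₁ c₁ → Priced t₂ o₂ d₂ c₂ → Priced (node x e t₁ t₂) o false (1 + (c₁ + c₂))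
    mark (priced {M₁} P₁ h₁) (priced {M₂} P₂ h₂) = priced (marked P₁ P₂) (begin
      1 + 3 * suc m                  ≡⟨ solve 1 (λ m → con 1 :+ con 3 :* (con 1 :+ m) := con 2 :+ (con 2 :+ con 3 :* m)) refl m ⟩
      2 + (2 + 3 * m)                ≤⟨ ℕ.+-monoʳ-≤ 2 (add-marks M₁ M₂ (labels t₁) (labels t₂) h₁ h₂) ⟩
      2 + (s + (c₁ + c₂))            ≡⟨ cong suc (ℕ.+-suc s (c₁ + c₂)) ⟨
      suc s + (1 + (c₁ + c₂))        ∎)
      where
      open ℕ.≤-Reasoning
      open +-*-Solver
      m = length (M₁ ++ M₂)
      s = length (labels t₁ ++ labels t₂)

    -- An unmarked root lowers the difference by 1, and merging the two shifts lowers the bound by 1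
    -- more.
    leave : ∀ {d c} → T (d ∨ o₁ ∨ o₂) → (T d₁ → T (d ∧ o₂)) → (T d₂ → T (d ∧ o₁)) → c₁ + c₂ ≡ 2 + c →
            Priced t₁ o₁ d₁ c₁ → Priced t₂ o₂ d₂ c₂ → Priced (node x e t₁ t₂) (o₁ ∧ o₂) d c
    leave {c = c} ok ok₁ ok₂ c-eq (priced {M₁} P₁ h₁) (priced {M₂} P₂ h₂) =
      priced (unmarked P₁ P₂ ok ok₁ ok₂) (ℕ.≤-pred (begin
        2 + 3 * m           ≤⟨ add-marks M₁ M₂ (labels t₁) (labels t₂) h₁ h₂ ⟩
        s + (c₁ + c₂)       ≡⟨ cong (s +_) c-eq ⟩
        s + (2 + c)         ≡⟨ solve 2 (λ s c → s :+ (con 2 :+ c) := con 2 :+ (s :+ c)) refl s c ⟩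
        2 + (s + c)         ∎))
      where
      open ℕ.≤-Reasoning
      open +-*-Solver
      m = length (M₁ ++ M₂)
      s = length (labels t₁ ++ labels t₂)

  -- The kinds (A), (B), (C).
  data Kind {p} (t : Tree p) : Set where
    neutral  : Priced t false false 1 → Kind t
    flexible : Priced t false true 0 → Priced t true false 3 → Kind t
    giving   : Priced t true false 2 → Kind t

  -- A flexible child always takes its cheap needy plan here: a marked root serves it directly, and
  -- an unmarked root relays to it what the parent and a giving sibling send. The dear giving plan
  -- is kept for `join`.
  kind : ∀ {p} (t : Tree p) → Kind t
  -- With two `empty` children a leaf becomes flexible: needy at -1 when unmarked, giving at 2 when
  -- marked.
  kind empty = neutral (priced none (s≤s z≤n))
  kind (node x e t₁ t₂) with kind t₁ | kind t₂
  ... | neutral a₁    | neutral a₂    = flexible (leave _ (λ ()) (λ ()) refl a₁ a₂) (mark a₁ a₂)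
  ... | neutral a₁    | flexible b₂ _ = giving (mark a₁ b₂)
  ... | flexible b₁ _ | neutral a₂    = giving (mark b₁ a₂)
  ... | flexible b₁ _ | flexible b₂ _ = neutral (mark b₁ b₂)
  ... | neutral a₁    | giving c₂     = neutral (leave _ (λ ()) (λ ()) refl a₁ c₂)
  ... | giving c₁     | neutral a₂    = neutral (leave _ (λ ()) (λ ()) refl c₁ a₂)
  ... | flexible b₁ _ | giving c₂     = flexible (leave _ _ (λ ()) refl b₁ c₂) (mark b₁ c₂)
  ... | giving c₁     | flexible b₂ _ = flexible (leave _ (λ ()) _ refl c₁ b₂) (mark c₁ b₂)
  ... | giving c₁     | giving c₂     = giving (leave _ (λ ()) (λ ()) refl c₁ c₂)

  -- Joining two trees across an edge

  record Joined {p q} (t : Tree p) (t′ : Tree q) : Set where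
    constructor joined
    field
      {o d o′ d′} : Bool
      {M M′} : List (Fin n)
      plan  : Plan t o d M
      plan′ : Plan t′ o′ d′ M′
      meets  : T d → T o′
      meets′ : T d′ → T o
      price : 3 * length (M ++ M′) ≤ length (labels t ++ labels t′) + 2

  join : ∀ {p q} (t : Tree p) (t′ : Tree q) → Joined t t′
  join t t′ = pair (kind t) (kind t′)
    where
    combine : ∀ {o d o′ d′ c c′} → (T d → T o′) → (T d′ → T o) → c + c′ ≤ 4 →
              Priced t o d c → Priced t′ o′ d′ c′ → Joined t t′
    combine {c = c} {c′} m m′ c+c′≤4 (priced {M} P h) (priced {M′} P′ h′) = joined P P′ m m′
      (ℕ.≤-pred (ℕ.≤-pred (begin
        2 + 3 * length (M ++ M′)  ≤⟨ add-marks M M′ (labels t) (labels t′) h h′ ⟩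
        s + (c + c′)              ≤⟨ ℕ.+-monoʳ-≤ s c+c′≤4 ⟩
        s + 4                     ≡⟨ solve 1 (λ s → s :+ con 4 := con 2 :+ (s :+ con 2)) refl s ⟩
        2 + (s + 2)               ∎)))
      where
      open ℕ.≤-Reasoning
      open +-*-Solver
      s = length (labels t ++ labels t′)
    pair : Kind t → Kind t′ → Joined t t′
    pair (neutral a)    (neutral a′)     = combine (λ ()) (λ ()) (ℕ.m≤m+n 2 2) a a′
    -- A neutral tree promises nothing, so its flexible partner must use the giving plan; the
    -- shifted prices 1 and 3 just meet the limit 4.
    pair (neutral a)    (flexible _ b′)  = combine (λ ()) (λ ()) ℕ.≤-refl a b′
    pair (neutral a)    (giving c′)      = combine (λ ()) (λ ()) (ℕ.n≤1+n 3) a c′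
    pair (flexible _ b) (neutral a′)     = combine (λ ()) (λ ()) ℕ.≤-refl b a′
    -- The giving plan of one side serves the needy plan of the other.
    pair (flexible b _) (flexible _ b′)  = combine _ (λ ()) (ℕ.n≤1+n 3) b b′
    pair (flexible b _) (giving c′)      = combine _ (λ ()) (ℕ.m≤m+n 2 2) b c′
    pair (giving c)     (neutral a′)     = combine (λ ()) (λ ()) (ℕ.n≤1+n 3) c a′
    pair (giving c)     (flexible b′ _)  = combine (λ ()) _ (ℕ.m≤m+n 2 2) c b′
    pair (giving c)     (giving c′)      = combine (λ ()) (λ ()) ℕ.≤-refl c c′

  -- Plans dominate

  module _ (S : Subset n) where

    -- Along any S-avoiding walk from u to x, the vertices of L deliver to u what
    -- remains of a contribution 1 to x.
    record Supply (x : Fin n) (L : List (Fin n)) : Set where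
      constructor supplies
      field deliver : ∀ {k u} → Walk S k u x → half^ k ≤ℚ sumOver (share S u) L
    open Supply

    supply-source : ∀ {x y L} → Adj G x y → y ∈ S → y ∈ₗ L → Supply x L
    supply-source e y∈S y∈L = supplies λ {_} {u} walk →
      ℚ.≤-trans (share-reach y∈S (_ , walk , e)) (∈⇒≤sumOver (share S u) (share-nonneg S u) y∈L)

    supply-++ˡ : ∀ {x L} L′ → Supply x L → Supply x (L ++ L′)
    supply-++ˡ {L = L} L′ sup = supplies λ {_} {u} walk →
      ℚ.≤-trans (deliver sup walk) (sumOver-++ˡ-≤ (share S u) (share-nonneg S u) L L′)

    supply-++ʳ : ∀ {x L′} L → Supply x L′ → Supply x (L ++ L′)
    supply-++ʳ {L′ = L′} L sup = supplies λ {_} {u} walk →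
      ℚ.≤-trans (deliver sup walk) (sumOver-++ʳ-≤ (share S u) (share-nonneg S u) L L′)

    -- A walk to `x` extends to `y` by one edge, so `L` and `L′` each deliver `half^ (suc k)` to its
    -- start, together `half^ k`.
    supply-relay : ∀ {x y} L L′ → Adj G x y → Supply y L → Supply y L′ → Supply x (y ∷ L ++ L′)
    supply-relay {x} {y} L L′ e sup sup′ = relay (y ∈? S)
      where
      open ℚ.≤-Reasoning
      relay : Dec (y ∈ S) → Supply x (y ∷ L ++ L′)
      -- A vertex left unmarked by a plan may still lie in `S`, as only the inclusion of the marks
      -- in `S` is assumed; then it is a source itself.
      relay (yes y∈S) = supply-source e y∈S (here refl)
      relay (no y∉S)  = supply-++ʳ (y ∷ []) (supplies λ {k} {u} walk →
        let walk′ = walk-snoc walk e y∉S in begin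
          half^ k                                          ≡⟨ half^-double k ⟨
          half^ (suc k) +ℚ half^ (suc k)                   ≤⟨ ℚ.+-mono-≤ (deliver sup walk′) (deliver sup′ walk′) ⟩
          sumOver (share S u) L +ℚ sumOver (share S u) L′  ≡⟨ sumOver-++ (share S u) L L′ ⟨
          sumOver (share S u) (L ++ L′)                    ∎)

    plan-supply : ∀ {p} {t : Tree p} {o d M} → (∀ {v} → v ∈ₗ M → v ∈ S) → Plan t o d M → T o → Supply p (labels t)
    plan-supply M⊆S (marked {e = e} _ _) _ = supply-source e (M⊆S (here refl)) (here refl)
    plan-supply M⊆S (unmarked {e = e} {t₁} {t₂} {M₁ = M₁} P₁ P₂ _ _ _) o =
      let o₁ , o₂ = Equivalence.to T-∧ o in
      supply-relay (labels t₁) (labels t₂) e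
        (plan-supply (M⊆S ∘ ∈-++⁺ˡ) P₁ o₁) (plan-supply (M⊆S ∘ ∈-++⁺ʳ M₁) P₂ o₂)

    RootSupply : ∀ {p} → Tree p → List (Fin n) → Set
    RootSupply empty          L = ⊤
    RootSupply (node x _ _ _) L = Supply x L

    child-supply : ∀ {p L} (t : Tree p) → (∀ {x} → Adj G x p → Supply x L) → RootSupply t L
    child-supply empty sup = tt
    child-supply (node x e _ _) sup = sup (Adj-sym e)

    module _ (V : List (Fin n)) where

      Dominated : Fin n → Set
      Dominated v = 1ℚ ≤ℚ sumOver (share S v) V

      ∈S⇒dominated : ∀ {v} → v ∈ₗ V → v ∈ S → Dominated v
      ∈S⇒dominated {v} v∈V v∈S = ℚ.≤-trans (share-self v∈S) (∈⇒≤sumOver (share S v) (share-nonneg S v) v∈V)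

      supplied⇒dominated : ∀ {v L} → v ∈ₗ V → L ↭ V → Supply v L → Dominated v
      supplied⇒dominated {v} v∈V L↭V sup = decide (v ∈? S)
        where
        decide : Dec (v ∈ S) → Dominated v
        decide (yes v∈S) = ∈S⇒dominated v∈V v∈S
        decide (no v∉S)  = ℚ.≤-trans (deliver sup (stay v∉S)) (ℚ.≤-reflexive (sumOver-↭ (share S v) L↭V))

      -- The list `O` holds all vertices outside `t`. For a child, the outside becomes `x`, the
      -- sibling subtree and the old `O`; the whole stays a rearrangement of `V`, so supplies from
      -- different branches come from separate parts of it and may be added.
      plan-dominates : ∀ {p} {t : Tree p} {o d M} → (∀ {v} → v ∈ₗ M → v ∈ S) → Plan t o d M →
                       ∀ O → labels t ++ O ↭ V → (T d → RootSupply t O) → All Dominated (labels t)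
      plan-dominates M⊆S none O _ _ = []
      plan-dominates M⊆S (marked {x} {t₁ = t₁} {t₂} {M₁ = M₁} P₁ P₂) O all↭ _ =
        ∈S⇒dominated (∈-resp-↭ all↭ (here refl)) x∈S ∷ All.++⁺
          (plan-dominates (M⊆S ∘ there ∘ ∈-++⁺ˡ) P₁ (x ∷ labels t₂ ++ O)
            (↭-trans (first-child-↭ x (labels t₁) (labels t₂) O) all↭)
            (λ _ → child-supply t₁ (λ e → supply-source e x∈S (here refl))))
          (plan-dominates (M⊆S ∘ there ∘ ∈-++⁺ʳ M₁) P₂ (x ∷ labels t₁ ++ O)
            (↭-trans (second-child-↭ x (labels t₁) (labels t₂) O) all↭)
            (λ _ → child-supply t₂ (λ e → supply-source e x∈S (here refl))))
        where x∈S = M⊆S (here refl)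
      plan-dominates M⊆S (unmarked {x} {t₁ = t₁} {t₂} {o₁} {o₂} {M₁ = M₁} {d = d} P₁ P₂ ok ok₁ ok₂) O all↭ need =
        supplied⇒dominated (∈-resp-↭ all↭ (here refl)) all↭ (supply-++ʳ (x ∷ []) root-supply) ∷ All.++⁺
          (plan-dominates (M⊆S ∘ ∈-++⁺ˡ) P₁ (x ∷ labels t₂ ++ O)
            (↭-trans (first-child-↭ x (labels t₁) (labels t₂) O) all↭)
            -- The needy first child is served through `x`, which receives 1 from the sibling and 1
            -- from outside.
            (λ d₁ → let d , o₂ = Equivalence.to T-∧ (ok₁ d₁) in
                    child-supply t₁ (λ e → supply-relay (labels t₂) O e (supply₂ o₂) (need d))))
          (plan-dominates (M⊆S ∘ ∈-++⁺ʳ M₁) P₂ (x ∷ labels t₁ ++ O)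
            (↭-trans (second-child-↭ x (labels t₁) (labels t₂) O) all↭)
            (λ d₂ → let d , o₁ = Equivalence.to T-∧ (ok₂ d₂) in
                    child-supply t₂ (λ e → supply-relay (labels t₁) O e (supply₁ o₁) (need d))))
        where
        supply₁ : T o₁ → Supply x (labels t₁)
        supply₁ = plan-supply (M⊆S ∘ ∈-++⁺ˡ) P₁
        supply₂ : T o₂ → Supply x (labels t₂)
        supply₂ = plan-supply (M⊆S ∘ ∈-++⁺ʳ M₁) P₂
        root-supply : Supply x ((labels t₁ ++ labels t₂) ++ O)
        root-supply with Equivalence.to (T-∨ {d}) ok
        ... | inj₁ d = supply-++ʳ (labels t₁ ++ labels t₂) (need d)
        ... | inj₂ o₁∨o₂ with Equivalence.to (T-∨ {o₁}) o₁∨o₂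
        ...   | inj₁ o₁ = supply-++ˡ O (supply-++ˡ (labels t₂) (supply₁ o₁))
        ...   | inj₂ o₂ = supply-++ˡ O (supply-++ʳ (labels t₁) (supply₂ o₂))

  -- From a dominated spanning tree to the bound

  ExpDominatingBound : Set
  ExpDominatingBound = Σ (Subset n) λ S → IsExpDominating G S × 3 * ∣ S ∣ ≤ n + 2

  module _ {V : List (Fin n)} (uniq : Unique V) (cover : ∀ v → v ∈ₗ V) where

    dominated⇒IsExpDominating : ∀ S → (∀ {v} → v ∈ₗ V → Dominated S V v) → IsExpDominating G S
    dominated⇒IsExpDominating S dom = distOf S , distOf-correct S , λ u →
      ℚ.≤-trans (dom (cover u)) (sumOver≤sumℚ (share S u) (share-nonneg S u) uniq)

    bounded : ∀ (M : List (Fin n)) → 3 * length M ≤ length V + 2 → 3 * ∣ fromList M ∣ ≤ n + 2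
    bounded M price = begin
      3 * ∣ fromList M ∣  ≤⟨ ℕ.*-monoʳ-≤ 3 (∣fromList∣≤length M) ⟩
      3 * length M        ≤⟨ price ⟩
      length V + 2        ≤⟨ ℕ.+-monoˡ-≤ 2 (Unique⇒length≤n uniq) ⟩
      n + 2               ∎
      where open ℕ.≤-Reasoning

    single-bound : ∀ {r} → V ≡ r ∷ [] → ExpDominatingBound
    single-bound {r} refl = fromList (r ∷ []) ,
      dominated⇒IsExpDominating _ (λ { (here refl) → ∈S⇒dominated _ (r ∷ []) {r} (here refl) (∈-fromList {xs = r ∷ []} (here refl)) }) ,
      -- Equality holds for one vertex: 3 = 1 + 2.
      bounded (r ∷ []) ℕ.≤-refl

    edge-bound : ∀ {r y} (e : Adj G r y) (s₁ s₂ : Tree y) (t₁ t₂ : Tree r) →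
                 (y ∷ labels s₁ ++ labels s₂) ++ (r ∷ labels t₁ ++ labels t₂) ↭ V → ExpDominatingBound
    edge-bound {r} {y} e s₁ s₂ t₁ t₂ all↭ =
      fromList M ,
      dominated⇒IsExpDominating _ (λ v∈V → All.lookup dominated (∈-resp-↭ (↭-sym all↭) v∈V)) ,
      bounded M (ℕ.≤-trans price (ℕ.≤-reflexive (cong (_+ 2) (↭-length all↭))))
      where
      -- The edge is seen from both ends: `s` has root `y` below `r`, and `t` has root `r` below
      -- `y`, so each tree makes its promise to the root of the other.
      s : Tree r
      s = node y e s₁ s₂
      t : Tree y
      t = node r (Adj-sym e) t₁ t₂
      open Joined (join s t) renaming (M to Mₛ)
      M = Mₛ ++ M′
      dominated : All (Dominated (fromList M) V) (labels s ++ labels t)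
      dominated = All.++⁺
        (plan-dominates _ V (∈-fromList ∘ ∈-++⁺ˡ) plan (labels t) all↭
          (λ d → plan-supply _ (∈-fromList ∘ ∈-++⁺ʳ Mₛ) plan′ (meets d)))
        (plan-dominates _ V (∈-fromList ∘ ∈-++⁺ʳ Mₛ) plan′ (labels s)
          (↭-trans (++-comm (labels t) (labels s)) all↭)
          (λ d′ → plan-supply _ (∈-fromList ∘ ∈-++⁺ˡ) plan (meets′ d′)))

theorem2 : (n : ℕ) (G : Graph n) → Connected G → MaxDegreeAtMost G 3 →
    Σ (Subset n) λ S → IsExpDominating G S × 3 * ∣ S ∣ ≤ n + 2
theorem2 zero G conn deg = [] , ((λ ()) , (λ ()) , λ ()) , z≤n
theorem2 (suc n) G conn deg with growAll G {zero} conn (allFin (suc n))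
... | (nil , uniq) , cover = single-bound G uniq (λ v → All.lookup cover (∈-allFin v)) refl
-- The edge from the root to its first child `y` splits the spanning tree. Regarding each end as the
-- parent of the other uses up one neighbour of both, which leaves at most two children each.
... | (cons y e F F′ , uniq) , cover
  with binarize G deg e F (Unique-resp-⊆ (refl ∷ refl ∷ Sublist.++⁺ʳ _ ⊆-refl) uniq)
     | binarize G deg (Adj-sym G e) F′
         (Unique-resp-↭ (swap zero y refl) (Unique-resp-⊆ (refl ∷ refl ∷ Sublist.++⁺ˡ (vertices G F) ⊆-refl) uniq))
... | s₁ , s₂ , eqₛ | t₁ , t₂ , eqₜ =
  edge-bound G uniq (λ v → All.lookup cover (∈-allFin v)) e s₁ s₂ t₁ t₂
    (↭-trans (↭-reflexive (cong₂ (λ l l′ → (y ∷ l) ++ zero ∷ l′) eqₛ eqₜ))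
             (shift zero (y ∷ vertices G F) (vertices G F′)))
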